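{- For every tree $T$ on $n \ge 2$ vertices: (i) $\alpha_{\mathrm{reg}}(T) \ge \frac{n+2}{4}$ (Albertson and Boutin); (ii) $\alpha_{1-\mathrm{reg}}(T) \ge \frac{2(n+2)}{7}$; and (iii) $\alpha_{k-\mathrm{reg}}(T) \ge \frac{n+2}{3}$ for $k \ge 2$. Moreover, all bounds are sharp.
   Context: For an integer $k \ge 0$, a $k$-independent set of a graph $G$ is a set of vertices whose induced subgraph has maximum degree at most $k$. The regular $k$-independence number $\alpha_{k-\mathrm{reg}}(G)$ is the maximum cardinality of a $k$-independent set of $G$ all of whose vertices have the same degree in $G$. The regular independence number is $\alpha_{\mathrm{reg}}(G) = \alpha_{0-\mathrm{reg}}(G)$, i.e. the maximum cardinality of an independent set of $G$ all of whose vertices have the same degree in $G$. -}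

module Defs where

open import Data.Bool.Base using (true; false)
open import Data.Fin.Base using (Fin)
open import Data.Fin.Properties using (all?)
open import Data.Fin.Subset using (Subset; inside; outside; _∈_; _∩_; ∣_∣; ⊥)
open import Data.Fin.Subset.Properties using (_∈?_; ∉⊥; ∣⊥∣≡0)
open import Data.List.Base using (List; []; _∷_; _++_; _∷ʳ_; length; map; filter)
open import Data.List.Extrema.Nat using (max; argmax-sel; xs≤max)
open import Data.List.Membership.Propositional using () renaming (_∈_ to _∈ˡ_)
open import Data.List.Membership.Propositional.Properties
  using (∈-map⁺; ∈-map⁻; ∈-++⁺ˡ; ∈-++⁺ʳ; ∈-filter⁺; ∈-filter⁻)
open import Data.List.Relation.Unary.All using (lookup)
open import Data.List.Relation.Unary.Any using (here)
open import Data.List.Relation.Unary.Linked using (Linked)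
open import Data.List.Relation.Unary.Unique.Propositional using (Unique)
import Data.Vec.Base as Vec
open import Data.Nat.Base using (ℕ; zero; suc; _≤_)
open import Data.Nat.Properties using (_≟_; _≤?_)
open import Data.Product.Base using (_×_; _,_; ∃-syntax; proj₂)
open import Data.Rational.Unnormalised.Base using (ℚᵘ; _≃_; _/_)
open import Data.Integer.Base using (+_)
open import Data.Sum.Base using (inj₁; inj₂)
open import Function.Base using (id)
open import Level using (0ℓ)
open import Relation.Binary.Construct.Closure.ReflexiveTransitive using (Star)
open import Relation.Binary.Core using (Rel)
open import Relation.Binary.Definitions using (Decidable; Irreflexive; Symmetric)
open import Relation.Binary.PropositionalEquality using (_≡_; refl; sym; trans)
open import Relation.Nullary.Decidable using (does; _×-dec_; _→-dec_)
open import Relation.Nullary.Negation using (¬_; contradiction)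
import Relation.Unary as U

record Graph (n : ℕ) : Set₁ where
  field
    _~_      : Rel (Fin n) 0ℓ
    _~?_     : Decidable _~_
    ~-sym    : Symmetric _~_
    ~-irrefl : Irreflexive _≡_ _~_

  neighbours : Fin n → Subset n
  neighbours v = Vec.tabulate λ w → does (v ~? w)

  degree : Fin n → ℕ
  degree v = ∣ neighbours v ∣

  -- For v ∈ S, the degree of v in the subgraph induced by S.
  degreeIn : Subset n → Fin n → ℕ
  degreeIn S v = ∣ neighbours v ∩ S ∣

  Connected : Set
  Connected = ∀ u v → Star _~_ u v

  -- The cycle v, vs, v: at least three distinct vertices, cyclically adjacent.
  record Cycle : Set where
    field
      v        : Fin n
      vs       : List (Fin n)
      long     : 2 ≤ length vs
      distinct : Unique (v ∷ vs)
      closed   : Linked _~_ (v ∷ vs ∷ʳ v)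

  IsTree : Set
  IsTree = Connected × ¬ Cycle

  IsIndependent : ℕ → Subset n → Set
  IsIndependent k S = ∀ v → v ∈ S → degreeIn S v ≤ k

  HasEqualDegrees : Subset n → Set
  HasEqualDegrees S = ∀ u v → u ∈ S → v ∈ S → degree u ≡ degree v

  IsRegularIndependent : ℕ → Subset n → Set
  IsRegularIndependent k S = IsIndependent k S × HasEqualDegrees S

  isRegularIndependent? : ∀ k → U.Decidable (IsRegularIndependent k)
  isRegularIndependent? k S =
    (all? λ v → (v ∈? S) →-dec (degreeIn S v ≤? k))
    ×-dec
    (all? λ u → all? λ v →
      (u ∈? S) →-dec ((v ∈? S) →-dec (degree u ≟ degree v)))

open Graph public using (IsTree)

subsets : ∀ n → List (Subset n)
subsets zero    = Vec.[] ∷ []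
subsets (suc n) = map (inside Vec.∷_) (subsets n) ++ map (outside Vec.∷_) (subsets n)

-- α k-reg T is the regular k-independence number of T.
infix 8 α_-reg_
α_-reg_ : ∀ {n} → ℕ → Graph n → ℕ
α_-reg_ {n} k G = max 0 (map ∣_∣ (filter (isRegularIndependent? k) (subsets n)))
  where open Graph G

αreg : ∀ {n} → Graph n → ℕ
αreg G = α 0 -reg G

∈-subsets : ∀ {n} (S : Subset n) → S ∈ˡ subsets n
∈-subsets Vec.[]            = here refl
∈-subsets (true  Vec.∷ S) = ∈-++⁺ˡ (∈-map⁺ (inside Vec.∷_) (∈-subsets S))
∈-subsets {suc n} (false Vec.∷ S) =
  ∈-++⁺ʳ (map (inside Vec.∷_) (subsets n)) (∈-map⁺ (outside Vec.∷_) (∈-subsets S))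

module _ {n} (k : ℕ) (G : Graph n) where
  open Graph G

  α-upperBound : ∀ S → IsRegularIndependent k S → ∣ S ∣ ≤ α k -reg G
  α-upperBound S p = lookup (xs≤max 0 _)
    (∈-map⁺ ∣_∣ (∈-filter⁺ (isRegularIndependent? k) (∈-subsets S) p))

  α-attained : ∃[ S ] (IsRegularIndependent k S × ∣ S ∣ ≡ α k -reg G)
  α-attained with argmax-sel id 0 (map ∣_∣ (filter (isRegularIndependent? k) (subsets n)))
  ... | inj₁ α≡0 =
        ⊥ , ((λ v v∈⊥ → contradiction v∈⊥ ∉⊥) , λ u v u∈⊥ → contradiction u∈⊥ ∉⊥)
          , trans (∣⊥∣≡0 n) (sym α≡0)
  ... | inj₂ α∈ with ∈-map⁻ ∣_∣ α∈
  ...   | S , S∈ , eq =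
          S , proj₂ (∈-filter⁻ (isRegularIndependent? k) {xs = subsets n} S∈) , sym eq

-- A lower bound in terms of the number n of vertices is sharp when it is attained
-- by trees with arbitrarily many vertices, not merely by some small exceptional tree.
SharpForTrees : (∀ {n} → Graph n → ℕ) → (ℕ → ℚᵘ) → Set₁
SharpForTrees parameter bound =
  ∀ N → ∃[ n ] (N ≤ n × 2 ≤ n ×
    ∃[ T ] (IsTree {n} T × (+ parameter T / 1) ≃ bound n))

{-# OPTIONS --safe #-}

-- In a tree the average degree is below 2 and only leaves lie below it, so the numbers nᵢ of
-- vertices of degree i satisfy n + 2 ≤ 2n₁ + n₂. For n ≥ 3 the leaves are independent; the vertices
-- of degree 2 induce paths, so at least 1/2, 2/3 or all of them can be kept for k = 0, 1, ≥ 2.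
-- This gives n + 2 ≤ 4α₀, 2(n + 2) ≤ 7α₁ and n + 2 ≤ 3αₖ. Depths from a root show all of this.
--
-- Equality holds for caterpillar-like trees: a spine of vertices of degree 3 carrying legs, which
-- are paths with 3 vertices for k = 0, alternately 4 and 1 for k = 1, and 2 for k ≥ 2.
module Submission where

open import Defs
import Algebra.Properties.CommutativeMonoid.Sum as Sum
open import Data.Bool.Base using (Bool; true; false; if_then_else_; not; _∧_)
open import Data.Bool.Properties using (not-¬) renaming (_≟_ to _≟ᵇ_)
open import Data.Empty using () renaming (⊥ to ⊥₀)
open import Data.Fin.Base as Fin using (Fin; zero; suc; _↑ˡ_; _↑ʳ_)
open import Data.Fin.Patterns using (0F; 1F; 2F; 3F; 4F; 5F; 6F)
import Data.Fin.Properties as Fin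
open import Data.Fin.Properties using (any?) renaming (_≟_ to _≟ᶠ_)
open import Data.Fin.Subset using (Subset; _∈_; _∉_; _⊆_; _∩_; ∣_∣; ⊥; ⁅_⁆)
open import Data.Fin.Subset.Properties
  using (_∈?_; nonempty?; ∣⊥∣≡0; ∣p∣≤n; p⊆q⇒∣p∣≤∣q∣; p⊂q⇒∣p∣<∣q∣; ∣⁅x⁆∣≡1; x∈⁅x⁆; x∈⁅y⁆⇒x≡y;
         x∈p∩q⁻; x∈p∩q⁺; ∣p∩q∣≤∣p∣; ∣p∣≤∣x∷p∣)
open import Data.Integer.Base as ℤ using (+_)
import Data.Integer.Properties as ℤ
open import Data.List.Base using (List; []; _∷_; _∷ʳ_)
import Data.List.Membership.DecPropositional as DecMem
open import Data.List.Membership.Propositional using () renaming (_∈_ to _∈ˡ_)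
open import Data.List.Relation.Unary.All as All using (All; []; _∷_)
open import Data.List.Relation.Unary.All.Properties using (¬Any⇒All¬)
open import Data.List.Relation.Unary.AllPairs using ([]; _∷_)
open import Data.List.Relation.Unary.Any using (here; there)
open import Data.List.Relation.Unary.Linked using (Linked; []; [-]; _∷_)
open import Data.List.Relation.Unary.Unique.Propositional using (Unique)
open import Data.Nat.Base using (ℕ; zero; suc; _+_; _*_; _≤_; _<_; z≤n; s≤s; s≤s⁻¹; NonZero)
open import Data.Nat.Properties
open import Data.Nat.Tactic.RingSolver using (solve-∀)
open import Data.Product.Base using (_×_; _,_; ∃-syntax; proj₁; proj₂)
open import Data.Rational.Unnormalised.Base using (_/_; _≃_; *≤*; *≡*) renaming (_≥_ to _≥ℚ_)
open import Data.Sum.Base using (_⊎_; inj₁; inj₂)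
open import Data.Vec.Base as Vec using (tabulate; _++_; []; _∷_; here; there)
open import Data.Vec.Properties using (lookup∘tabulate; []=⇒lookup; lookup⇒[]=)
open import Function.Base using (_∘_; case_of_)
open import Relation.Binary.Construct.Closure.ReflexiveTransitive using (Star; ε; _◅_; _◅◅_; reverse; gmap)
open import Relation.Binary.Definitions using (tri<; tri≈; tri>)
open import Relation.Binary.PropositionalEquality
open import Relation.Nullary.Decidable using (Dec; does; yes; no; _×-dec_; ¬?; dec-true; dec-false)
open import Relation.Nullary.Negation using (¬_; contradiction)
import Relation.Unary as U

open Sum +-0-commutativeMonoid using (sum; sum-cong-≗; ∑-distrib-+; ∑-comm)

-- The leg lengths come from the equality case. Equality in `n + 2 ≤ 2n₁ + n₂` allows no degree
-- above 3, and the ratio of n₂ to n₁ must be 2, 3/2 or 1, the reciprocal of the fraction of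
-- degree-2 vertices that can be kept. A leg of 3 vertices has two of degree 2 per leaf, legs of 4
-- and 1 together have three per two leaves, and a leg of 2 has one per leaf.
--
-- Acyclicity is the absence of a cyclic list of vertices, which suits neither direction. The lower
-- bounds consume it, turned into uniqueness of the neighbour nearer to a root. The examples must
-- produce it: there every vertex has at most one neighbour of larger index, an invariant that
-- survives attaching a leaf at index zero.

private variable
  m n k a β : ℕ
  A : Set

-- Counting with indicators and decidable subsets.

𝟙 : Dec A → ℕ
𝟙 a? = if does a? then 1 else 0

𝟙-yes : (a? : Dec A) → A → 𝟙 a? ≡ 1
𝟙-yes a? a rewrite dec-true a? a = refl

𝟙-no : (a? : Dec A) → ¬ A → 𝟙 a? ≡ 0
𝟙-no a? ¬a rewrite dec-false a? ¬a = refl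

sum-mono : {f g : Fin n → ℕ} → (∀ i → f i ≤ g i) → sum f ≤ sum g
sum-mono {n = zero}  f≤g = z≤n
sum-mono {n = suc n} f≤g = +-mono-≤ (f≤g zero) (sum-mono (f≤g ∘ suc))

sum-const : ∀ n c → sum {n} (λ _ → c) ≡ n * c
sum-const zero    c = refl
sum-const (suc n) c = cong (_+_ c) (sum-const n c)

-- Has the shape of `neighbours`, so `neighbours v` is `⟪ v ~?_ ⟫` by definition, and one set of
-- lemmas covers neighbourhoods, parents, children and degree classes.
⟪_⟫ : {P : Fin n → Set} → U.Decidable P → Subset n
⟪ P? ⟫ = tabulate (does ∘ P?)

module _ {P : Fin n → Set} (P? : U.Decidable P) where

  ∈⟪⟫⁺ : ∀ {x} → P x → x ∈ ⟪ P? ⟫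
  ∈⟪⟫⁺ {x} p = lookup⇒[]= x ⟪ P? ⟫ (trans (lookup∘tabulate (does ∘ P?) x) (dec-true (P? x) p))

  ∈⟪⟫⁻ : ∀ {x} → x ∈ ⟪ P? ⟫ → P x
  ∈⟪⟫⁻ {x} x∈ with P? x | trans (sym (lookup∘tabulate (does ∘ P?) x)) ([]=⇒lookup x∈)
  ... | yes p | _ = p

∣⟪⟫∣≡sum : {P : Fin n → Set} (P? : U.Decidable P) → ∣ ⟪ P? ⟫ ∣ ≡ sum (𝟙 ∘ P?)
∣⟪⟫∣≡sum {n = zero}  P? = refl
∣⟪⟫∣≡sum {n = suc n} P? with does (P? zero)
... | true  = cong suc (∣⟪⟫∣≡sum (P? ∘ suc))
... | false = ∣⟪⟫∣≡sum (P? ∘ suc)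

sum-𝟙-≟ : (x : Fin n) → sum (λ v → 𝟙 (v ≟ᶠ x)) ≡ 1
sum-𝟙-≟ x = trans (sym (∣⟪⟫∣≡sum (_≟ᶠ x))) (≤-antisym le ge)
  where
  le : ∣ ⟪ _≟ᶠ x ⟫ ∣ ≤ 1
  le = subst (∣ ⟪ _≟ᶠ x ⟫ ∣ ≤_) (∣⁅x⁆∣≡1 x)
    (p⊆q⇒∣p∣≤∣q∣ λ v∈ → subst (_∈ ⁅ x ⁆) (sym (∈⟪⟫⁻ (_≟ᶠ x) v∈)) (x∈⁅x⁆ x))
  ge : 1 ≤ ∣ ⟪ _≟ᶠ x ⟫ ∣
  ge = subst (_≤ ∣ ⟪ _≟ᶠ x ⟫ ∣) (∣⁅x⁆∣≡1 x)
    (p⊆q⇒∣p∣≤∣q∣ λ v∈ → ∈⟪⟫⁺ (_≟ᶠ x) (x∈⁅y⁆⇒x≡y x v∈))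

x∈p⇒1≤∣p∣ : {p : Subset n} {x : Fin n} → x ∈ p → 1 ≤ ∣ p ∣
x∈p⇒1≤∣p∣ {p = p} {x} x∈p = subst (_≤ ∣ p ∣) (∣⁅x⁆∣≡1 x)
  (p⊆q⇒∣p∣≤∣q∣ λ v∈ → subst (_∈ p) (sym (x∈⁅y⁆⇒x≡y x v∈)) x∈p)

∣p∣≤1⇒≡ : {p : Subset n} → ∣ p ∣ ≤ 1 → ∀ {x y} → x ∈ p → y ∈ p → x ≡ y
∣p∣≤1⇒≡ {p = p} ∣p∣≤1 {x} {y} x∈ y∈ with y ≟ᶠ x
... | yes y≡x = sym y≡x
... | no  y≢x = contradiction ∣p∣≤1 (<⇒≱ (subst (_< ∣ p ∣) (∣⁅x⁆∣≡1 x)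
  (p⊂q⇒∣p∣<∣q∣ ((λ v∈ → subst (_∈ p) (sym (x∈⁅y⁆⇒x≡y x v∈)) x∈) , y , y∈ , y≢x ∘ x∈⁅y⁆⇒x≡y x))))

empty⇒∣p∣≤0 : {p : Subset n} → (∀ x → x ∉ p) → ∣ p ∣ ≤ 0
empty⇒∣p∣≤0 {n = n} ∄x = ≤-trans
  (p⊆q⇒∣p∣≤∣q∣ {q = ⊥} λ {y} y∈ → contradiction y∈ (∄x y)) (≤-reflexive (∣⊥∣≡0 n))

≡⇒∣p∣≤1 : {p : Subset n} → (∀ x y → x ∈ p → y ∈ p → x ≡ y) → ∣ p ∣ ≤ 1
≡⇒∣p∣≤1 {p = p} eq with any? (_∈? p)
... | yes (x , x∈) = subst (∣ p ∣ ≤_) (∣⁅x⁆∣≡1 x)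
        (p⊆q⇒∣p∣≤∣q∣ λ {y} y∈ → subst (_∈ ⁅ x ⁆) (eq x y x∈ y∈) (x∈⁅x⁆ x))
... | no  ∄x = m≤n⇒m≤1+n (empty⇒∣p∣≤0 λ x x∈ → ∄x (x , x∈))

least : {P : ℕ → Set} → U.Decidable P → ∀ k → P k → ∃[ m ] (P m × ∀ j → P j → m ≤ j)
least P? zero    p = 0 , p , λ _ _ → z≤n
least P? (suc k) p with P? 0 | least (P? ∘ suc) k p
... | yes p₀ | _ = 0 , p₀ , λ _ _ → z≤n
... | no ¬p₀ | m , pm , min = suc m , pm , λ where
      zero    p₀ → contradiction p₀ ¬p₀
      (suc j) pj → s≤s (min j pj)

-- From walks to paths to cycles.

module _ (G : Graph n) where
  open Graph G
  open DecMem (_≟ᶠ_ {n}) using () renaming (_∈?_ to _∈ˡ?_)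

  data Path (w : Fin n) : List (Fin n) → Set where
    [_] : ∀ {u} → u ≡ w → Path w (u ∷ [])
    _∷_ : ∀ {u x xs} → u ~ x → Path w (x ∷ xs) → Path w (u ∷ x ∷ xs)

  path⇒linked : ∀ {w v xs} → Path w xs → w ~ v → Linked _~_ (xs ∷ʳ v)
  path⇒linked [ refl ]   w~v = w~v ∷ [-]
  path⇒linked (u~x ∷ p)  w~v = u~x ∷ path⇒linked p w~v

  -- The condition sits on both ends of each step, so that walks avoiding `v` can be concatenated
  -- and reversed as ordinary `Star` values.
  Avoiding : Fin n → Fin n → Fin n → Set
  Avoiding v u w = u ~ w × v ≢ u × v ≢ w

  suffix : ∀ {u w v xs} → u ∈ˡ xs → Path w xs → Unique xs → All (v ≢_) xs →
           ∃[ ys ] (Path w (u ∷ ys) × Unique (u ∷ ys) × All (v ≢_) (u ∷ ys))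
  suffix (here refl) p un al = _ , p , un , al
  suffix (there ())  [ _ ]
  suffix (there u∈)  (_ ∷ p) (_ ∷ un) (_ ∷ al) = suffix u∈ p un al

  -- Loop erasure: if the start `u` already lies on the simplified rest, `suffix` restarts the path
  -- there.
  simplify : ∀ {u w v} → v ≢ u → Star (Avoiding v) u w →
             ∃[ xs ] (Path w (u ∷ xs) × Unique (u ∷ xs) × All (v ≢_) (u ∷ xs))
  simplify v≢u ε = [] , [ refl ] , [] ∷ [] , v≢u ∷ []
  simplify {u} v≢u ((u~x , _ , v≢x) ◅ walk) with simplify v≢x walk
  ... | xs , p , un , al with u ∈ˡ? (_ ∷ xs)
  ...   | yes u∈ = suffix u∈ p un al
  ...   | no  u∉ = _ , u~x ∷ p , ¬Any⇒All¬ _ u∉ ∷ un , v≢u ∷ al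

  -- A simple path from `u` to `w` with at least one edge closes up through `v` to a cycle on three
  -- or more vertices.
  acyclic⇒≡ : ¬ Cycle → ∀ {u v w} → v ~ u → v ~ w → Star (Avoiding v) u w → u ≡ w
  acyclic⇒≡ ¬cycle {u} {v} {w} v~u v~w walk
    with simplify (λ v≡u → ~-irrefl v≡u v~u) walk
  ... | []     , [ u≡w ] , _ , _ = u≡w
  ... | x ∷ xs , p , un , al = contradiction
        record { v = v ; vs = u ∷ x ∷ xs ; long = s≤s (s≤s z≤n) ; distinct = al ∷ un
               ; closed = v~u ∷ path⇒linked p (~-sym v~w) }
        ¬cycle

-- Rooted trees: depth, parents and the number of edges.

module Rooted (T : Graph n) (T-tree : IsTree T) (r : Fin n) where
  open Graph T

  -- Recursion on the exact length makes this decidable on a finite vertex set, so `least` can find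
  -- the shortest walk.
  Reach : ℕ → Fin n → Set
  Reach zero    v = v ≡ r
  Reach (suc k) v = ∃[ w ] (v ~ w × Reach k w)

  reach? : ∀ k → U.Decidable (Reach k)
  reach? zero    v = v ≟ᶠ r
  reach? (suc k) v = any? λ w → (v ~? w) ×-dec reach? k w

  reach : ∀ {v} → Star _~_ v r → ∃[ k ] Reach k v
  reach ε            = 0 , refl
  reach (v~w ◅ walk) with reach walk
  ... | k , w-reach = suc k , _ , v~w , w-reach

  shortest : ∀ v → ∃[ k ] (Reach k v × ∀ j → Reach j v → k ≤ j)
  shortest v with reach (proj₁ T-tree v r)
  ... | k , v-reach = least (λ j → reach? j v) k v-reach

  depth : Fin n → ℕ
  depth v = proj₁ (shortest v)

  depth-reach : ∀ v → Reach (depth v) v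
  depth-reach v = proj₁ (proj₂ (shortest v))

  depth-min : ∀ {v} j → Reach j v → depth v ≤ j
  depth-min {v} = proj₂ (proj₂ (shortest v))

  depth-~ : ∀ {v w} → v ~ w → depth v ≤ suc (depth w)
  depth-~ {v} {w} v~w = depth-min (suc (depth w)) (w , v~w , depth-reach w)

  depth≡0⇒root : ∀ {v} → depth v ≡ 0 → v ≡ r
  depth≡0⇒root {v} eq = subst (λ k → Reach k v) eq (depth-reach v)

  depth-suc : ∀ {v k} → depth v ≡ suc k → ∃[ w ] (v ~ w × depth w ≡ k)
  depth-suc {v} {k} eq with subst (λ j → Reach j v) eq (depth-reach v)
  ... | w , v~w , w-reach = w , v~w ,
        ≤-antisym (depth-min k w-reach) (s≤s⁻¹ (subst (_≤ suc (depth w)) eq (depth-~ v~w)))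

  -- Every step goes one level down. `v` differs from the start by assumption, and from every later
  -- vertex because those lie strictly lower than `v`.
  descend : ∀ {v} k u → depth u ≡ k → v ≢ u → k ≤ depth v → Star (Avoiding T v) u r
  descend zero u du≡k v≢u k≤dv with depth≡0⇒root du≡k
  ... | refl = ε
  descend {v} (suc k) u du≡k v≢u k<dv with depth-suc du≡k
  ... | w , u~w , dw≡k = (u~w , v≢u , v≢w) ◅ descend k w dw≡k v≢w (<⇒≤ k<dv)
    where
    v≢w : v ≢ w
    v≢w refl = <-irrefl (sym dw≡k) k<dv

  -- Otherwise v would close a cycle: descending walks from u and w to the root avoid v.
  lower-unique : ∀ {u v w} → v ~ u → v ~ w → depth u ≤ depth v → depth w ≤ depth v → u ≡ w
  lower-unique {u} {v} {w} v~u v~w du≤dv dw≤dv = acyclic⇒≡ T (proj₂ T-tree) v~u v~w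
    (descend _ u refl (~⇒≢ v~u) du≤dv ◅◅ reverse flip (descend _ w refl (~⇒≢ v~w) dw≤dv))
    where
    ~⇒≢ : ∀ {x y} → x ~ y → x ≢ y
    ~⇒≢ x~y x≡y = ~-irrefl x≡y x~y
    flip : ∀ {x y} → Avoiding T v x y → Avoiding T v y x
    flip (x~y , v≢x , v≢y) = ~-sym x~y , v≢y , v≢x

  -- At equal positive depth, `lower-unique` would identify `w` with the neighbour of `v` one level
  -- lower; at depth zero both ends would be the root.
  depth-≢ : ∀ {v w} → v ~ w → depth v ≢ depth w
  depth-≢ {v} {w} v~w dv≡dw with depth v in dv
  ... | zero  = ~-irrefl (trans (depth≡0⇒root dv) (sym (depth≡0⇒root (sym dv≡dw)))) v~w
  ... | suc k with depth-suc dv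
  ...   | u , v~u , du≡k with lower-unique v~w v~u (≤-reflexive (trans (sym dv≡dw) (sym dv)))
                              (subst₂ _≤_ (sym du≡k) (sym dv) (n≤1+n k))
  ...     | refl = 1+n≢n (trans dv≡dw du≡k)

  IsParent : Fin n → Fin n → Set
  IsParent v w = v ~ w × depth v ≡ suc (depth w)

  isParent? : ∀ v w → Dec (IsParent v w)
  isParent? v w = (v ~? w) ×-dec (depth v ≟ suc (depth w))

  ~⇒parent : ∀ {v w} → v ~ w → IsParent v w ⊎ IsParent w v
  ~⇒parent {v} {w} v~w with <-cmp (depth v) (depth w)
  ... | tri< dv<dw _ _ = inj₂ (~-sym v~w , ≤-antisym (depth-~ (~-sym v~w)) dv<dw)
  ... | tri≈ _ dv≡dw _ = contradiction dv≡dw (depth-≢ v~w)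
  ... | tri> _ _ dw<dv = inj₁ (v~w , ≤-antisym (depth-~ v~w) dw<dv)

  parent-unique : ∀ {v u w} → IsParent v u → IsParent v w → u ≡ w
  parent-unique (v~u , du) (v~w , dw) =
    lower-unique v~u v~w (≤-trans (n≤1+n _) (≤-reflexive (sym du))) (≤-trans (n≤1+n _) (≤-reflexive (sym dw)))

  parent-asym : ∀ {v w} → IsParent v w → ¬ IsParent w v
  parent-asym (_ , dv) (_ , dw) = <-asym (≤-reflexive (sym dv)) (≤-reflexive (sym dw))

  root-no-parent : ∀ {w} → ¬ IsParent r w
  root-no-parent (_ , dr) with trans (sym (n≤0⇒n≡0 (depth-min {r} 0 refl))) dr
  ... | ()

  parent-exists : ∀ {v} → v ≢ r → ∃[ w ] IsParent v w
  parent-exists {v} v≢r with depth v in dv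
  ... | zero  = contradiction (depth≡0⇒root dv) v≢r
  ... | suc k with depth-suc dv
  ...   | w , v~w , dw = w , v~w , cong suc (sym dw)

  parents children : Fin n → Subset n
  parents  v = ⟪ isParent? v ⟫
  children v = ⟪ (λ w → isParent? w v) ⟫

  ∣parents∣≤1 : ∀ v → ∣ parents v ∣ ≤ 1
  ∣parents∣≤1 v = ≡⇒∣p∣≤1 λ _ _ x∈ y∈ →
    parent-unique (∈⟪⟫⁻ (isParent? v) x∈) (∈⟪⟫⁻ (isParent? v) y∈)

  -- Depths along an edge differ by exactly one, so exactly one end is the parent of the other.
  degree≡ : ∀ v → degree v ≡ ∣ parents v ∣ + ∣ children v ∣
  degree≡ v = begin
    degree v                                               ≡⟨ ∣⟪⟫∣≡sum (v ~?_) ⟩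
    sum (λ w → 𝟙 (v ~? w))                                 ≡⟨ sum-cong-≗ split ⟩
    sum (λ w → 𝟙 (isParent? v w) + 𝟙 (isParent? w v))
      ≡⟨ ∑-distrib-+ (λ w → 𝟙 (isParent? v w)) (λ w → 𝟙 (isParent? w v)) ⟩
    sum (λ w → 𝟙 (isParent? v w)) + sum (λ w → 𝟙 (isParent? w v))
      ≡⟨ cong₂ _+_ (∣⟪⟫∣≡sum (isParent? v)) (∣⟪⟫∣≡sum (λ w → isParent? w v)) ⟨
    ∣ parents v ∣ + ∣ children v ∣                         ∎
    where
    open ≡-Reasoning
    split : ∀ w → 𝟙 (v ~? w) ≡ 𝟙 (isParent? v w) + 𝟙 (isParent? w v)
    split w with v ~? w
    ... | no ¬v~w = sym (cong₂ _+_
          (𝟙-no (no ¬v~w ×-dec (depth v ≟ suc (depth w))) (¬v~w ∘ proj₁))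
          (𝟙-no (isParent? w v) (¬v~w ∘ ~-sym ∘ proj₁)))
    ... | yes v~w with ~⇒parent v~w
    ...   | inj₁ p = sym (cong₂ _+_ (𝟙-yes (yes v~w ×-dec (depth v ≟ suc (depth w))) p)
                                    (𝟙-no (isParent? w v) (parent-asym p)))
    ...   | inj₂ q = sym (cong₂ _+_ (𝟙-no (yes v~w ×-dec (depth v ≟ suc (depth w))) (parent-asym q))
                                    (𝟙-yes (isParent? w v) q))

  -- Each edge is charged to its child and so counted once.
  edges : ℕ
  edges = sum (λ v → ∣ parents v ∣)

  sum-children : sum (λ v → ∣ children v ∣) ≡ edges
  sum-children = begin
    sum (λ v → ∣ children v ∣)                  ≡⟨ sum-cong-≗ (λ v → ∣⟪⟫∣≡sum (λ w → isParent? w v)) ⟩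
    sum (λ v → sum (λ w → 𝟙 (isParent? w v)))   ≡⟨ ∑-comm (λ v w → 𝟙 (isParent? w v)) ⟩
    sum (λ w → sum (λ v → 𝟙 (isParent? w v)))   ≡⟨ sum-cong-≗ (λ w → ∣⟪⟫∣≡sum (isParent? w)) ⟨
    edges                                       ∎
    where open ≡-Reasoning

  sum-degree : sum degree ≡ edges + edges
  sum-degree = begin
    sum degree                                         ≡⟨ sum-cong-≗ degree≡ ⟩
    sum (λ v → ∣ parents v ∣ + ∣ children v ∣)         ≡⟨ ∑-distrib-+ (∣_∣ ∘ parents) (∣_∣ ∘ children) ⟩
    edges + sum (λ v → ∣ children v ∣)                 ≡⟨ cong (_+_ edges) sum-children ⟩
    edges + edges                                      ∎
    where open ≡-Reasoning

  -- Every vertex is charged at most one edge and the root none; the indicator of the root fills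
  -- that gap and makes the inequality strict.
  edges<n : edges < n
  edges<n = begin-strict
    edges                                          <⟨ n<1+n edges ⟩
    1 + edges                                      ≡⟨ cong (_+ edges) (sum-𝟙-≟ r) ⟨
    sum (λ v → 𝟙 (v ≟ᶠ r)) + edges                 ≡⟨ ∑-distrib-+ (λ v → 𝟙 (v ≟ᶠ r)) (∣_∣ ∘ parents) ⟨
    sum (λ v → 𝟙 (v ≟ᶠ r) + ∣ parents v ∣)         ≤⟨ sum-mono bound ⟩
    sum {n} (λ _ → 1)                              ≡⟨ trans (sum-const n 1) (*-identityʳ n) ⟩
    n                                              ∎
    where
    open ≤-Reasoning
    bound : ∀ v → 𝟙 (v ≟ᶠ r) + ∣ parents v ∣ ≤ 1
    bound v with v ≟ᶠ r
    ... | yes refl = s≤s (empty⇒∣p∣≤0 λ w w∈ → root-no-parent (∈⟪⟫⁻ (isParent? r) w∈))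
    ... | no  _    = ∣parents∣≤1 v

-- Residues of depths modulo 2 and 3.

odd : ℕ → Bool
odd zero    = false
odd (suc k) = not (odd k)

rotate : Fin 3 → Fin 3
rotate 0F = 1F
rotate 1F = 2F
rotate 2F = 0F

mod3 : ℕ → Fin 3
mod3 zero    = 0F
mod3 (suc k) = rotate (mod3 k)

rotate³ : ∀ i → rotate (rotate (rotate i)) ≡ i
rotate³ 0F = refl
rotate³ 1F = refl
rotate³ 2F = refl

-- With `i` the residue of the depth of a vertex, `rotate i` is the residue of its children, and
-- `rotate (rotate i)`, one step back modulo 3, that of its parent.
rotate-or : ∀ i j → i ≢ j → rotate i ≡ j ⊎ rotate (rotate i) ≡ j
rotate-or 0F 0F i≢j = contradiction refl i≢j
rotate-or 0F 1F _   = inj₁ refl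
rotate-or 0F 2F _   = inj₂ refl
rotate-or 1F 0F _   = inj₂ refl
rotate-or 1F 1F i≢j = contradiction refl i≢j
rotate-or 1F 2F _   = inj₁ refl
rotate-or 2F 0F _   = inj₁ refl
rotate-or 2F 1F _   = inj₂ refl
rotate-or 2F 2F i≢j = contradiction refl i≢j

∃-≢ : 2 ≤ n → (v : Fin n) → ∃[ u ] v ≢ u
∃-≢ (s≤s (s≤s _)) zero    = 1F , λ ()
∃-≢ (s≤s (s≤s _)) (suc v) = 0F , λ ()

-- The three lower bounds.

module LowerBounds (T : Graph n) (T-tree : IsTree T) (2≤n : 2 ≤ n) where
  open Graph T

  ofDegree : ℕ → Subset n
  ofDegree k = ⟪ (λ v → degree v ≟ k) ⟫

  degree-positive : ∀ v → 1 ≤ degree v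
  degree-positive v with ∃-≢ 2≤n v
  ... | u , v≢u with proj₁ T-tree v u
  ...   | ε       = contradiction refl v≢u
  ...   | v~w ◅ _ = x∈p⇒1≤∣p∣ (∈⟪⟫⁺ (v ~?_) v~w)

  -- The average degree is less than 2, and only leaves are below it.
  n+2≤2n₁+n₂ : n + 2 ≤ ∣ ofDegree 1 ∣ + ∣ ofDegree 1 ∣ + ∣ ofDegree 2 ∣
  n+2≤2n₁+n₂ = +-cancelˡ-≤ (n + n) _ _ (begin
    n + n + (n + 2)                                  ≡⟨ shuffle n ⟩
    n * 3 + 2                                        ≡⟨ cong (_+ 2) (sum-const n 3) ⟨
    sum {n} (λ _ → 3) + 2                            ≤⟨ +-monoˡ-≤ 2 (sum-mono bound) ⟩
    sum (λ v → degree v + (is 1 v + is 1 v + is 2 v)) + 2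
      ≡⟨ cong (_+ 2) (trans (∑-distrib-+ degree (λ v → is 1 v + is 1 v + is 2 v))
           (cong₂ _+_ sum-degree (trans (∑-distrib-+ (λ v → is 1 v + is 1 v) (is 2))
             (cong₂ _+_ (trans (∑-distrib-+ (is 1) (is 1)) (cong₂ _+_ (∣ofDegree∣ 1) (∣ofDegree∣ 1))) (∣ofDegree∣ 2))))) ⟩
    edges + edges + X + 2                            ≡⟨ shuffle′ edges X ⟩
    suc edges + suc edges + X                        ≤⟨ +-monoˡ-≤ X (+-mono-≤ edges<n edges<n) ⟩
    n + n + X                                        ∎)
    where
    open ≤-Reasoning
    -- An arbitrary root: the existence of a leaf is derived from this very inequality.
    open Rooted T T-tree (proj₁ (∃-≢ 2≤n (Fin.fromℕ< (≤-trans (s≤s z≤n) 2≤n))))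
    X = ∣ ofDegree 1 ∣ + ∣ ofDegree 1 ∣ + ∣ ofDegree 2 ∣
    is : ℕ → Fin n → ℕ
    is k v = 𝟙 (degree v ≟ k)
    ∣ofDegree∣ : ∀ k → sum (is k) ≡ ∣ ofDegree k ∣
    ∣ofDegree∣ k = sym (∣⟪⟫∣≡sum (λ v → degree v ≟ k))
    shuffle : ∀ m → m + m + (m + 2) ≡ m * 3 + 2
    shuffle = solve-∀
    shuffle′ : ∀ e x → e + e + x + 2 ≡ suc e + suc e + x
    shuffle′ = solve-∀
    bound : ∀ v → 3 ≤ degree v + (is 1 v + is 1 v + is 2 v)
    bound v with degree v | degree-positive v
    ... | 1                 | _ = ≤-refl
    ... | 2                 | _ = ≤-refl
    ... | suc (suc (suc _)) | _ = s≤s (s≤s (s≤s z≤n))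

  -- Without leaves the inequality above would give n + 2 ≤ n₂ ≤ n.
  leaf : ∃[ r ] degree r ≡ 1
  leaf with any? (λ v → degree v ≟ 1)
  ... | yes r = r
  ... | no ¬r = contradiction n+2≤2n₁+n₂ (<⇒≱ (begin-strict
    ∣ ofDegree 1 ∣ + ∣ ofDegree 1 ∣ + ∣ ofDegree 2 ∣  ≤⟨ +-mono-≤ (+-mono-≤ n₁≤0 n₁≤0) (∣p∣≤n (ofDegree 2)) ⟩
    n                                                 <⟨ m<m+n n (s≤s z≤n) ⟩
    n + 2                                             ∎))
    where
    open ≤-Reasoning
    n₁≤0 : ∣ ofDegree 1 ∣ ≤ 0
    n₁≤0 = empty⇒∣p∣≤0 λ v v∈ → ¬r (v , ∈⟪⟫⁻ (λ v → degree v ≟ 1) v∈)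

  -- With a leaf as root, every vertex of degree 2 has a parent and hence exactly one child.
  open Rooted T T-tree (proj₁ leaf)

  same-degree⇒≤α : ∀ k d (S : Subset n) → (∀ v → v ∈ S → degree v ≡ d) → IsIndependent k S → ∣ S ∣ ≤ α k -reg T
  same-degree⇒≤α k d S deg ind = α-upperBound k T S
    (ind , λ u v u∈ v∈ → trans (deg u u∈) (sym (deg v v∈)))

  -- Edges join depths of opposite parity, so parity splits a degree class into two independent
  -- sets.
  nₖ≤2α₀ : ∀ k → ∣ ofDegree k ∣ ≤ αreg T + αreg T
  nₖ≤2α₀ k = begin
    ∣ ofDegree k ∣                                   ≡⟨ ∣⟪⟫∣≡sum (λ v → degree v ≟ k) ⟩
    sum (λ v → 𝟙 (degree v ≟ k))                     ≡⟨ sum-cong-≗ split ⟩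
    sum (λ v → 𝟙 (class? false v) + 𝟙 (class? true v))
      ≡⟨ ∑-distrib-+ (𝟙 ∘ class? false) (𝟙 ∘ class? true) ⟩
    sum (𝟙 ∘ class? false) + sum (𝟙 ∘ class? true)
      ≡⟨ cong₂ _+_ (∣⟪⟫∣≡sum (class? false)) (∣⟪⟫∣≡sum (class? true)) ⟨
    ∣ ⟪ class? false ⟫ ∣ + ∣ ⟪ class? true ⟫ ∣       ≤⟨ +-mono-≤ (class≤α false) (class≤α true) ⟩
    αreg T + αreg T                                  ∎
    where
    open ≤-Reasoning
    Class : Bool → Fin n → Set
    Class b v = degree v ≡ k × odd (depth v) ≡ b
    class? : ∀ b → U.Decidable (Class b)
    class? b v = (degree v ≟ k) ×-dec (odd (depth v) ≟ᵇ b)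
    split : ∀ v → 𝟙 (degree v ≟ k) ≡ 𝟙 (class? false v) + 𝟙 (class? true v)
    split v with does (degree v ≟ k) | odd (depth v)
    ... | true  | true  = refl
    ... | true  | false = refl
    ... | false | true  = refl
    ... | false | false = refl
    parent-class : ∀ {b v w} → IsParent v w → Class b v → Class b w → ⊥₀
    parent-class (_ , eq) (_ , v-odd) (_ , w-odd) =
      not-¬ refl (trans w-odd (trans (sym v-odd) (cong odd eq)))
    class≤α : ∀ b → ∣ ⟪ class? b ⟫ ∣ ≤ αreg T
    class≤α b = same-degree⇒≤α 0 k _ (λ v v∈ → proj₁ (∈⟪⟫⁻ (class? b) v∈)) λ v v∈ → empty⇒∣p∣≤0 λ w w∈ →
      let w∈N , w∈C = x∈p∩q⁻ (neighbours v) ⟪ class? b ⟫ w∈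
          cv = ∈⟪⟫⁻ (class? b) v∈
          cw = ∈⟪⟫⁻ (class? b) w∈C
      in case ~⇒parent (∈⟪⟫⁻ (v ~?_) w∈N) of λ where
           (inj₁ p) → parent-class p cv cw
           (inj₂ p) → parent-class p cw cv

  -- Every vertex of degree 2 has one parent and one child, so deleting a class of depths modulo 3
  -- leaves paths with at most two vertices.
  2n₂≤3α₁ : ∣ ofDegree 2 ∣ + ∣ ofDegree 2 ∣ ≤ α 1 -reg T + (α 1 -reg T + α 1 -reg T)
  2n₂≤3α₁ = begin
    ∣ ofDegree 2 ∣ + ∣ ofDegree 2 ∣                  ≡⟨ cong₂ _+_ (∣⟪⟫∣≡sum deg2?) (∣⟪⟫∣≡sum deg2?) ⟩
    sum (𝟙 ∘ deg2?) + sum (𝟙 ∘ deg2?)                ≡⟨ ∑-distrib-+ (𝟙 ∘ deg2?) (𝟙 ∘ deg2?) ⟨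
    sum (λ v → 𝟙 (deg2? v) + 𝟙 (deg2? v))            ≡⟨ sum-cong-≗ split ⟩
    sum (λ v → 𝟙 (class? 0F v) + (𝟙 (class? 1F v) + 𝟙 (class? 2F v)))
      ≡⟨ ∑-distrib-+ (𝟙 ∘ class? 0F) (λ v → 𝟙 (class? 1F v) + 𝟙 (class? 2F v)) ⟩
    sum (𝟙 ∘ class? 0F) + sum (λ v → 𝟙 (class? 1F v) + 𝟙 (class? 2F v))
      ≡⟨ cong (_+_ (sum (𝟙 ∘ class? 0F))) (∑-distrib-+ (𝟙 ∘ class? 1F) (𝟙 ∘ class? 2F)) ⟩
    sum (𝟙 ∘ class? 0F) + (sum (𝟙 ∘ class? 1F) + sum (𝟙 ∘ class? 2F))
      ≡⟨ cong₂ _+_ (∣⟪⟫∣≡sum (class? 0F)) (cong₂ _+_ (∣⟪⟫∣≡sum (class? 1F)) (∣⟪⟫∣≡sum (class? 2F))) ⟨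
    ∣ ⟪ class? 0F ⟫ ∣ + (∣ ⟪ class? 1F ⟫ ∣ + ∣ ⟪ class? 2F ⟫ ∣)
      ≤⟨ +-mono-≤ (class≤α 0F) (+-mono-≤ (class≤α 1F) (class≤α 2F)) ⟩
    α 1 -reg T + (α 1 -reg T + α 1 -reg T)           ∎
    where
    open ≤-Reasoning
    deg2? : ∀ v → Dec (degree v ≡ 2)
    deg2? v = degree v ≟ 2
    Class : Fin 3 → Fin n → Set
    Class c v = degree v ≡ 2 × mod3 (depth v) ≢ c
    class? : ∀ c → U.Decidable (Class c)
    class? c v = deg2? v ×-dec ¬? (mod3 (depth v) ≟ᶠ c)
    -- A vertex of degree 2 is missing from one of the three classes only, so it is counted twice.
    split : ∀ v → 𝟙 (deg2? v) + 𝟙 (deg2? v) ≡ 𝟙 (class? 0F v) + (𝟙 (class? 1F v) + 𝟙 (class? 2F v))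
    split v with does (deg2? v) | mod3 (depth v)
    ... | true  | 0F = refl
    ... | true  | 1F = refl
    ... | true  | 2F = refl
    ... | false | 0F = refl
    ... | false | 1F = refl
    ... | false | 2F = refl
    ∣children∣≤1 : ∀ v → degree v ≡ 2 → ∣ children v ∣ ≤ 1
    ∣children∣≤1 v deg with v ≟ᶠ proj₁ leaf
    ... | yes refl = contradiction (trans (sym (proj₂ leaf)) deg) λ ()
    ... | no  v≢r  = s≤s⁻¹ (begin
      1 + ∣ children v ∣
        ≤⟨ +-monoˡ-≤ ∣ children v ∣ (x∈p⇒1≤∣p∣ (∈⟪⟫⁺ (isParent? v) (proj₂ (parent-exists v≢r)))) ⟩
      ∣ parents v ∣ + ∣ children v ∣                 ≡⟨ trans (sym (degree≡ v)) deg ⟩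
      2                                              ∎)
    class≤α : ∀ c → ∣ ⟪ class? c ⟫ ∣ ≤ α 1 -reg T
    class≤α c = same-degree⇒≤α 1 2 S (λ v v∈ → proj₁ (∈⟪⟫⁻ (class? c) v∈)) λ v v∈ →
      let deg , mod≢c = ∈⟪⟫⁻ (class? c) v∈ in
      -- The deleted residue is that of the children or that of the parent of `v`. What remains of
      -- the neighbourhood lies on the other side, where there is at most one vertex.
      case rotate-or (mod3 (depth v)) c mod≢c of λ where
        (inj₁ child≡c) → ≤-trans (p⊆q⇒∣p∣≤∣q∣ (only-parents v child≡c)) (∣parents∣≤1 v)
        (inj₂ parent≡c) → ≤-trans (p⊆q⇒∣p∣≤∣q∣ (only-children v parent≡c)) (∣children∣≤1 v deg)
      where
      S = ⟪ class? c ⟫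
      only-parents : ∀ v → rotate (mod3 (depth v)) ≡ c → neighbours v ∩ S ⊆ parents v
      only-parents v child≡c {w} w∈ with x∈p∩q⁻ (neighbours v) S w∈
      ... | w∈N , w∈S with ~⇒parent (∈⟪⟫⁻ (v ~?_) w∈N)
      ...   | inj₁ p        = ∈⟪⟫⁺ (isParent? v) p
      ...   | inj₂ (_ , dw) = contradiction (trans (cong mod3 dw) child≡c) (proj₂ (∈⟪⟫⁻ (class? c) w∈S))
      only-children : ∀ v → rotate (rotate (mod3 (depth v))) ≡ c → neighbours v ∩ S ⊆ children v
      only-children v parent≡c {w} w∈ with x∈p∩q⁻ (neighbours v) S w∈
      ... | w∈N , w∈S with ~⇒parent (∈⟪⟫⁻ (v ~?_) w∈N)
      ...   | inj₂ p        = ∈⟪⟫⁺ (λ w → isParent? w v) p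
      ...   | inj₁ (_ , dv) = contradiction
        (trans (sym (rotate³ _)) (trans (cong (rotate ∘ rotate ∘ mod3) (sym dv)) parent≡c))
        (proj₂ (∈⟪⟫⁻ (class? c) w∈S))

  -- A walk from `u` can only alternate between `u` and `w`, so connectedness leaves no third
  -- vertex.
  adjacent-leaves⇒n≤2 : ∀ {u w} → u ~ w → degree u ≡ 1 → degree w ≡ 1 → n ≤ 2
  adjacent-leaves⇒n≤2 {u} {w} u~w deg-u deg-w = begin
    n                                                  ≡⟨ trans (sum-const n 1) (*-identityʳ n) ⟨
    sum {n} (λ _ → 1)                                  ≤⟨ sum-mono bound ⟩
    sum (λ v → 𝟙 (v ≟ᶠ u) + 𝟙 (v ≟ᶠ w))                ≡⟨ ∑-distrib-+ (λ v → 𝟙 (v ≟ᶠ u)) (λ v → 𝟙 (v ≟ᶠ w)) ⟩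
    sum (λ v → 𝟙 (v ≟ᶠ u)) + sum (λ v → 𝟙 (v ≟ᶠ w))    ≡⟨ cong₂ _+_ (sum-𝟙-≟ u) (sum-𝟙-≟ w) ⟩
    2                                                  ∎
    where
    open ≤-Reasoning
    only-neighbour : ∀ {x y z} → degree x ≡ 1 → x ~ y → x ~ z → y ≡ z
    only-neighbour {x} deg x~y x~z = ∣p∣≤1⇒≡ (≤-reflexive deg) (∈⟪⟫⁺ (x ~?_) x~y) (∈⟪⟫⁺ (x ~?_) x~z)
    stays : ∀ {x v} → x ≡ u ⊎ x ≡ w → Star _~_ x v → v ≡ u ⊎ v ≡ w
    stays x∈ ε = x∈
    stays (inj₁ refl) (u~y ◅ walk) = stays (inj₂ (only-neighbour deg-u u~y u~w)) walk
    stays (inj₂ refl) (w~y ◅ walk) = stays (inj₁ (only-neighbour deg-w w~y (~-sym u~w))) walk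
    bound : ∀ v → 1 ≤ 𝟙 (v ≟ᶠ u) + 𝟙 (v ≟ᶠ w)
    bound v with stays (inj₁ refl) (proj₁ T-tree u v)
    ... | inj₁ v≡u = ≤-trans (≤-reflexive (sym (𝟙-yes (v ≟ᶠ u) v≡u))) (m≤m+n _ _)
    ... | inj₂ v≡w = ≤-trans (≤-reflexive (sym (𝟙-yes (v ≟ᶠ w) v≡w))) (m≤n+m _ _)

  -- A vertex of degree at most `k` has at most `k` neighbours in any set, so its whole degree class
  -- qualifies.
  nₖ≤α : ∀ {k d} → d ≤ k → ∣ ofDegree d ∣ ≤ α k -reg T
  nₖ≤α {k} {d} d≤k = same-degree⇒≤α k d _ (λ v → deg) λ v v∈ →
    ≤-trans (∣p∩q∣≤∣p∣ (neighbours v) (ofDegree d)) (≤-trans (≤-reflexive (deg v∈)) d≤k)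
    where
    deg : ∀ {v} → v ∈ ofDegree d → degree v ≡ d
    deg = ∈⟪⟫⁻ (λ v → degree v ≟ d)

  1≤α₀ : 1 ≤ αreg T
  1≤α₀ with αreg T | nₖ≤2α₀ 1
  ... | zero  | n₁≤0 = contradiction
    (≤-trans (x∈p⇒1≤∣p∣ (∈⟪⟫⁺ (λ v → degree v ≟ 1) (proj₂ leaf))) n₁≤0) λ ()
  ... | suc _ | _    = s≤s z≤n

  n₁≤α₀ : 3 ≤ n → ∣ ofDegree 1 ∣ ≤ αreg T
  n₁≤α₀ 3≤n = same-degree⇒≤α 0 1 _ (λ v → deg) λ v v∈ → empty⇒∣p∣≤0 λ w w∈ →
    let w∈N , w∈L = x∈p∩q⁻ (neighbours v) (ofDegree 1) w∈
    in <⇒≱ 3≤n (adjacent-leaves⇒n≤2 (∈⟪⟫⁻ (v ~?_) w∈N) (deg v∈) (deg w∈L))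
    where
    deg : ∀ {v} → v ∈ ofDegree 1 → degree v ≡ 1
    deg = ∈⟪⟫⁻ (λ v → degree v ≟ 1)

  α₀-bound : n + 2 ≤ αreg T * 4
  α₀-bound with 3 ≤? n
  ... | yes 3≤n = begin
    n + 2                                              ≤⟨ n+2≤2n₁+n₂ ⟩
    ∣ ofDegree 1 ∣ + ∣ ofDegree 1 ∣ + ∣ ofDegree 2 ∣
      ≤⟨ +-mono-≤ (+-mono-≤ (n₁≤α₀ 3≤n) (n₁≤α₀ 3≤n)) (nₖ≤2α₀ 2) ⟩
    αreg T + αreg T + (αreg T + αreg T)                ≡⟨ collect (αreg T) ⟩
    αreg T * 4                                         ∎
    where
    open ≤-Reasoning
    collect : ∀ a → a + a + (a + a) ≡ a * 4
    collect = solve-∀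
  ... | no 3≰n = ≤-trans (+-monoˡ-≤ 2 (s≤s⁻¹ (≰⇒> 3≰n))) (*-monoˡ-≤ 4 1≤α₀)

  -- Doubling clears the factor 3/2 between n₂ and α₁: the leaves then contribute 4 and the vertices
  -- of degree 2 contribute 3.
  α₁-bound : 2 * (n + 2) ≤ α 1 -reg T * 7
  α₁-bound = begin
    2 * (n + 2)                                        ≤⟨ *-monoʳ-≤ 2 n+2≤2n₁+n₂ ⟩
    2 * (n₁ + n₁ + n₂)                                 ≡⟨ expand n₁ n₂ ⟩
    n₁ * 4 + (n₂ + n₂)                                 ≤⟨ +-mono-≤ (*-monoˡ-≤ 4 (nₖ≤α ≤-refl)) 2n₂≤3α₁ ⟩
    α 1 -reg T * 4 + (α 1 -reg T + (α 1 -reg T + α 1 -reg T))  ≡⟨ collect (α 1 -reg T) ⟩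
    α 1 -reg T * 7                                     ∎
    where
    open ≤-Reasoning
    n₁ = ∣ ofDegree 1 ∣
    n₂ = ∣ ofDegree 2 ∣
    expand : ∀ a b → 2 * (a + a + b) ≡ a * 4 + (b + b)
    expand = solve-∀
    collect : ∀ a → a * 4 + (a + (a + a)) ≡ a * 7
    collect = solve-∀

  αₖ-bound : ∀ k → 2 ≤ k → n + 2 ≤ α k -reg T * 3
  αₖ-bound k 2≤k = begin
    n + 2                                              ≤⟨ n+2≤2n₁+n₂ ⟩
    ∣ ofDegree 1 ∣ + ∣ ofDegree 1 ∣ + ∣ ofDegree 2 ∣
      ≤⟨ +-mono-≤ (+-mono-≤ (nₖ≤α 1≤k) (nₖ≤α 1≤k)) (nₖ≤α 2≤k) ⟩
    α k -reg T + α k -reg T + α k -reg T               ≡⟨ collect (α k -reg T) ⟩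
    α k -reg T * 3                                     ∎
    where
    open ≤-Reasoning
    1≤k : 1 ≤ k
    1≤k = <⇒≤ 2≤k
    collect : ∀ a → a + a + a ≡ a * 3
    collect = solve-∀

-- Trees grown by attaching leaves.

-- The new vertex is zero and the old ones are shifted by suc.
infixl 5 _◂_
_◂_ : Graph n → Fin n → Graph (suc n)
_◂_ {n} G v = record { _~_ = _~′_ ; _~?_ = _~′?_ ; ~-sym = λ {x} {y} → sym′ {x} {y} ; ~-irrefl = irrefl′ }
  where
  open Graph G
  _~′_ : Fin (suc n) → Fin (suc n) → Set
  zero  ~′ zero  = ⊥₀
  zero  ~′ suc w = w ≡ v
  suc u ~′ zero  = u ≡ v
  suc u ~′ suc w = u ~ w
  _~′?_ : ∀ x y → Dec (x ~′ y)
  zero  ~′? zero  = no λ ()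
  zero  ~′? suc w = w ≟ᶠ v
  suc u ~′? zero  = u ≟ᶠ v
  suc u ~′? suc w = u ~? w
  sym′ : ∀ {x y} → x ~′ y → y ~′ x
  sym′ {zero}  {suc _} eq  = eq
  sym′ {suc _} {zero}  eq  = eq
  sym′ {suc _} {suc _} u~w = ~-sym u~w
  irrefl′ : ∀ {x y} → x ≡ y → ¬ (x ~′ y)
  irrefl′ {suc _} refl u~u = ~-irrefl refl u~u

-- The larger neighbour of a vertex is the one it was attached to. A new vertex at index zero has a
-- single neighbour and is nobody's larger neighbour, so the invariant persists.
record Grown (G : Graph n) : Set where
  open Graph G hiding (IsTree)
  field
    connected     : Connected
    higher-unique : ∀ {v u w} → v ~ u → v ~ w → v Fin.< u → v Fin.< w → u ≡ w

  -- A walk without backtracking that has stepped to a smaller vertex keeps descending.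
  no-return : ∀ {a b v xs} → b Fin.< a → b Fin.< v → a ≢ v →
              Linked _~_ (a ∷ b ∷ xs ∷ʳ v) → ¬ Unique (a ∷ b ∷ xs)
  no-return {xs = []} b<a b<v a≢v (a~b ∷ b~v ∷ _) _ =
    a≢v (higher-unique (~-sym a~b) b~v b<a b<v)
  no-return {xs = c ∷ _} b<a b<v a≢v (a~b ∷ b~c ∷ link) ((_ ∷ a≢c ∷ _) ∷ un) with Fin.<-cmp c _
  ... | tri< c<b _ _  = no-return c<b (Fin.<-trans c<b b<v) (λ { refl → Fin.<-irrefl refl b<v }) (b~c ∷ link) un
  ... | tri≈ _ refl _ = ~-irrefl refl b~c
  ... | tri> _ _ b<c  = a≢c (higher-unique (~-sym a~b) b~c b<a b<c)

  -- The only neighbour through which the walk could reach `v` from above is `y`, which it does not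
  -- meet again. So it must pass from above `v` to below `v`, and from there `no-return` applies.
  no-crossing : ∀ {a b v y xs} → v Fin.< a → v ~ y → v Fin.< y → All (y ≢_) (b ∷ xs) → All (v ≢_) (b ∷ xs) →
                Linked _~_ (a ∷ b ∷ xs ∷ʳ v) → ¬ Unique (a ∷ b ∷ xs)
  no-crossing {b = b} {v} v<a v~y v<y y∉ v∉ link un with Fin.<-cmp b v
  ... | tri< b<v _ _  = no-return (Fin.<-trans b<v v<a) b<v (λ { refl → Fin.<-irrefl refl v<a }) link un
  ... | tri≈ _ refl _ = All.head v∉ refl
  no-crossing {xs = []} v<a v~y v<y y∉ v∉ (_ ∷ b~v ∷ _) un | tri> _ _ v<b =
    All.head y∉ (higher-unique v~y (~-sym b~v) v<y v<b)
  no-crossing {xs = _ ∷ _} v<a v~y v<y (_ ∷ y∉) (_ ∷ v∉) (_ ∷ link) (_ ∷ un) | tri> _ _ v<b =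
    no-crossing v<b v~y v<y y∉ v∉ link un

  -- A first step up from `v` is excluded by `no-crossing`. After a first step down to `y`, going
  -- further down is excluded by `no-return`, and going up would give `y` two larger neighbours `v`
  -- and `c`.
  acyclic : ¬ Cycle
  acyclic record { vs = _ ∷ [] ; long = s≤s () }
  acyclic record { v = v ; vs = y ∷ c ∷ xs ; distinct = (v≢y ∷ v≢c ∷ v∉) ∷ (y∉ ∷ un) ; closed = v~y ∷ link }
    with Fin.<-cmp y v
  ... | tri≈ _ refl _ = v≢y refl
  ... | tri> _ _ v<y  = no-crossing v<y v~y v<y y∉ (v≢c ∷ v∉) link (y∉ ∷ un)
  ... | tri< y<v _ _ with link | Fin.<-cmp c y
  ...   | y~c ∷ _ | tri< c<y _ _  = no-return c<y (Fin.<-trans c<y y<v) (v≢y ∘ sym) link (y∉ ∷ un)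
  ...   | y~c ∷ _ | tri≈ _ refl _ = ~-irrefl refl y~c
  ...   | y~c ∷ _ | tri> _ _ y<c  = v≢c (higher-unique (~-sym v~y) y~c y<v y<c)

  isTree : IsTree G
  isTree = connected , acyclic

module _ (G : Graph n) where

  ◂-grown : ∀ {v} → Grown G → Grown (G ◂ v)
  ◂-grown {v} grown = record { connected = connected′ ; higher-unique = λ {x} {y} {z} → unique′ {x} {y} {z} }
    where
    open Grown grown
    open Graph (G ◂ v)
    connected′ : Connected
    connected′ zero    zero    = ε
    connected′ zero    (suc w) = refl ◅ gmap suc (λ e → e) (connected v w)
    connected′ (suc u) zero    = gmap suc (λ e → e) (connected u v) ◅◅ refl ◅ ε
    connected′ (suc u) (suc w) = gmap suc (λ e → e) (connected u w)
    unique′ : ∀ {x y z} → x ~ y → x ~ z → x Fin.< y → x Fin.< z → y ≡ z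
    unique′ {zero}  {suc _} {suc _} refl refl _ _ = refl
    unique′ {suc _} {suc _} {suc _} x~y x~z x<y x<z = cong suc (higher-unique x~y x~z (s≤s⁻¹ x<y) (s≤s⁻¹ x<z))

  degree-new : ∀ v → Graph.degree (G ◂ v) zero ≡ 1
  degree-new v = trans (∣⟪⟫∣≡sum (_≟ᶠ v)) (sum-𝟙-≟ v)

  ◂-independent : ∀ v b {S : Subset n} → Graph.IsIndependent (G ◂ v) k (b ∷ S) → Graph.IsIndependent G k S
  ◂-independent v b {S} ind u u∈ = ≤-trans (∣p∣≤∣x∷p∣ (does (u ≟ᶠ v) ∧ b) (Graph.neighbours G u ∩ S)) (ind (suc u) (there u∈))

single : Graph 1
single = record { _~_ = λ _ _ → ⊥₀ ; _~?_ = λ _ _ → no λ () ; ~-sym = λ () ; ~-irrefl = λ _ () }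

single-grown : Grown single
single-grown = record { connected = λ { zero zero → ε } ; higher-unique = λ () }

-- Upper bounds that add up over blocks of new vertices.

record Pointed : Set₁ where
  constructor _,_
  field
    {size} : ℕ
    graph  : Graph size
    tip    : Fin size

-- The tip r of an unfinished tree is still to receive one more neighbour.
degree⁺ : Graph n → Fin n → Fin n → ℕ
degree⁺ G r u = Graph.degree (G ◂ r) (suc u)

-- e d leaves room for vertices of degree d that are added later.
Bounded : ℕ → (ℕ → ℕ) → ℕ → (Fin n → ℕ) → Graph n → Set
Bounded k e a D G = ∀ d S → (∀ {u} → u ∈ S → D u ≡ d) → Graph.IsIndependent G k S → ∣ S ∣ + e d ≤ a

∣p++q∣ : (p : Subset m) (q : Subset n) → ∣ p ++ q ∣ ≡ ∣ p ∣ + ∣ q ∣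
∣p++q∣ []          q = refl
∣p++q∣ (true ∷ p)  q = cong suc (∣p++q∣ p q)
∣p++q∣ (false ∷ p) q = ∣p++q∣ p q

∈-++⁺ˡ : {p : Subset m} (q : Subset n) {i : Fin m} → i ∈ p → i ↑ˡ n ∈ p ++ q
∈-++⁺ˡ q here       = here
∈-++⁺ˡ q (there i∈) = there (∈-++⁺ˡ q i∈)

∈-++⁺ʳ : (p : Subset m) {q : Subset n} {i : Fin n} → i ∈ q → m ↑ʳ i ∈ p ++ q
∈-++⁺ʳ []      i∈ = i∈
∈-++⁺ʳ (_ ∷ p) i∈ = there (∈-++⁺ʳ p i∈)

occurrences : (Fin m → ℕ) → ℕ → ℕ
occurrences D d = ∣ ⟪ (λ i → D i ≟ d) ⟫ ∣

module _ {D : Fin m → ℕ} {d} {B : Subset m} (D≡d : ∀ {i} → i ∈ B → D i ≡ d) where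

  ∣B∣≤occurrences : ∣ B ∣ ≤ occurrences D d
  ∣B∣≤occurrences = p⊆q⇒∣p∣≤∣q∣ λ i∈ → ∈⟪⟫⁺ (λ i → D i ≟ d) (D≡d i∈)

  ∣B∣<occurrences : ∀ {i} → i ∉ B → D i ≡ d → ∣ B ∣ < occurrences D d
  ∣B∣<occurrences i∉ Di≡d = p⊂q⇒∣p∣<∣q∣ ((λ i∈ → ∈⟪⟫⁺ (λ i → D i ≟ d) (D≡d i∈)) , _ , ∈⟪⟫⁺ (λ i → D i ≟ d) Di≡d , i∉)

module _ {G : Graph n} {S : Subset n} where
  open Graph G

  0-independent : IsIndependent 0 S → ∀ {u v} → u ∈ S → v ∈ S → ¬ u ~ v
  0-independent ind {u} u∈ v∈ u~v =
    contradiction (≤-trans (x∈p⇒1≤∣p∣ (x∈p∩q⁺ (∈⟪⟫⁺ (u ~?_) u~v , v∈))) (ind u u∈)) λ ()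

  1-independent : IsIndependent 1 S → ∀ {u v w} → u ∈ S → v ∈ S → w ∈ S → u ~ v → u ~ w → v ≡ w
  1-independent ind {u} u∈ v∈ w∈ u~v u~w =
    ∣p∣≤1⇒≡ (ind u u∈) (x∈p∩q⁺ (∈⟪⟫⁺ (u ~?_) u~v , v∈)) (x∈p∩q⁺ (∈⟪⟫⁺ (u ~?_) u~w , w∈))

  module _ {f : Fin m → Fin n} {B : Subset m} (f∈ : ∀ {i} → i ∈ B → f i ∈ S)
           {D : Fin m → ℕ} {d} (D≡d : ∀ {i} → i ∈ B → D i ≡ d) (occ≤ : occurrences D d ≤ suc β) where

    -- Of two adjacent vertices of degree `d` one is not chosen, so `B` falls short of all
    -- occurrences of `d`. The map `f` places the block in the graph.
    edge-bound : IsIndependent 0 S → ∀ i j → D i ≡ d → D j ≡ d → f i ~ f j → ∣ B ∣ ≤ β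
    edge-bound ind i j Di Dj i~j with i ∈? B | j ∈? B
    ... | no i∉  | _      = s≤s⁻¹ (≤-trans (∣B∣<occurrences D≡d i∉ Di) occ≤)
    ... | yes _  | no j∉  = s≤s⁻¹ (≤-trans (∣B∣<occurrences D≡d j∉ Dj) occ≤)
    ... | yes i∈ | yes j∈ = contradiction i~j (0-independent ind (f∈ i∈) (f∈ j∈))

    -- If all of a path of three were chosen, its middle vertex would have two chosen neighbours; so
    -- one of the three is lost.
    path-bound : IsIndependent 1 S → ∀ i j k → D i ≡ d → D j ≡ d → D k ≡ d →
                 f j ~ f i → f j ~ f k → f i ≢ f k → ∣ B ∣ ≤ β
    path-bound ind i j k Di Dj Dk j~i j~k i≢k with i ∈? B | j ∈? B | k ∈? B
    ... | no i∉  | _      | _      = s≤s⁻¹ (≤-trans (∣B∣<occurrences D≡d i∉ Di) occ≤)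
    ... | yes _  | no j∉  | _      = s≤s⁻¹ (≤-trans (∣B∣<occurrences D≡d j∉ Dj) occ≤)
    ... | yes _  | yes _  | no k∉  = s≤s⁻¹ (≤-trans (∣B∣<occurrences D≡d k∉ Dk) occ≤)
    ... | yes i∈ | yes j∈ | yes k∈ = contradiction (1-independent ind (f∈ j∈) (f∈ i∈) (f∈ k∈) j~i j~k) i≢k

-- A selection splits into its part `B` among the new vertices and the old rest `S`, and the two
-- bounds add. Room left by `e` may be spent by `B` or passed on in `e′`.
extend-bound : ∀ {e e′ D D′} (G : Graph n) (G′ : Graph (m + n)) (Dₘ : Fin m → ℕ) →
  (∀ i → D′ (i ↑ˡ n) ≡ Dₘ i) → (∀ u → D′ (m ↑ʳ u) ≡ D u) →
  (∀ B {S} → Graph.IsIndependent G′ k (B ++ S) → Graph.IsIndependent G k S) →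
  (∀ d B {S} → (∀ {i} → i ∈ B → Dₘ i ≡ d) → Graph.IsIndependent G′ k (B ++ S) → ∣ B ∣ + e′ d ≤ β + e d) →
  Bounded k e a D G → Bounded k e′ (β + a) D′ G′
extend-bound {m = m} {k} {β} {a} {e} {e′} G G′ Dₘ new old restrict local bound d BS D≡d ind with Vec.splitAt m BS
... | B , S , refl = begin
  ∣ B ++ S ∣ + e′ d         ≡⟨ cong (_+ e′ d) (∣p++q∣ B S) ⟩
  ∣ B ∣ + ∣ S ∣ + e′ d      ≡⟨ swap ∣ B ∣ ∣ S ∣ (e′ d) ⟩
  (∣ B ∣ + e′ d) + ∣ S ∣    ≤⟨ +-monoˡ-≤ ∣ S ∣ (local d B (λ i∈ → trans (sym (new _)) (D≡d (∈-++⁺ˡ S i∈))) ind) ⟩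
  (β + e d) + ∣ S ∣         ≡⟨ trans (+-assoc β (e d) ∣ S ∣) (cong (_+_ β) (+-comm (e d) ∣ S ∣)) ⟩
  β + (∣ S ∣ + e d)         ≤⟨ +-monoʳ-≤ β (bound d S (λ u∈ → trans (sym (old _)) (D≡d (∈-++⁺ʳ B u∈))) (restrict B ind)) ⟩
  β + a                     ∎
  where
  open ≤-Reasoning
  swap : ∀ x y z → x + y + z ≡ x + z + y
  swap = solve-∀

-- A maximum set takes its common degree `d` from any member; the empty set has none and is treated
-- apart.
bounded⇒α≤ : ∀ {G : Graph n} → Bounded k (λ _ → 0) a (Graph.degree G) G → α k -reg G ≤ a
bounded⇒α≤ {n = n} {k = k} {a = a} {G} bound with α-attained k G
... | S , (ind , equal) , ∣S∣≡α with nonempty? S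
...   | yes (v , v∈) = subst (_≤ a) (trans (+-identityʳ _) ∣S∣≡α) (bound _ S (λ u∈ → equal _ v u∈ v∈) ind)
...   | no  empty    = subst (_≤ a) ∣S∣≡α (≤-trans (empty⇒∣p∣≤0 λ x x∈ → empty (x , x∈)) z≤n)

none : ℕ → ℕ
none _ = 0

-- Extremal trees for `k` at least 2.

-- A step attaches a spine vertex x to the tip and a leg p, q to x; the new indices run q, p, x.
module Legs2 where

  step : Pointed → Pointed
  step (G , r) = G ◂ r ◂ 0F ◂ 0F , 2F

  spine : ℕ → Pointed
  spine zero    = single ◂ 0F , 0F
  spine (suc m) = step (spine m)

  tree : ∀ m → Graph (2 + Pointed.size (spine m))
  tree m = let G , r = spine m in G ◂ r ◂ 0F

  spine-grown : ∀ m → Grown (Pointed.graph (spine m))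
  spine-grown zero    = ◂-grown _ single-grown
  spine-grown (suc m) = ◂-grown _ (◂-grown _ (◂-grown _ (spine-grown m)))

  tree-grown : ∀ m → Grown (tree m)
  tree-grown m = ◂-grown _ (◂-grown _ (spine-grown m))

  occurrences≤1 : ∀ d → occurrences (Vec.lookup (1 ∷ 2 ∷ 3 ∷ [])) d ≤ 1
  occurrences≤1 0                         = z≤n
  occurrences≤1 1                         = ≤-refl
  occurrences≤1 2                         = ≤-refl
  occurrences≤1 3                         = ≤-refl
  occurrences≤1 (suc (suc (suc (suc _)))) = z≤n

  occurrences≤1′ : ∀ d → occurrences (Vec.lookup (1 ∷ 2 ∷ [])) d ≤ 1
  occurrences≤1′ 0                   = z≤n
  occurrences≤1′ 1                   = ≤-refl
  occurrences≤1′ 2                   = ≤-refl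
  occurrences≤1′ (suc (suc (suc _))) = z≤n

  -- Each step adds one vertex of each degree 1, 2, 3, and the starting pair has degrees 1 and 2. So
  -- equal degrees alone allow one vertex per block, whatever `k` is.
  spine-bound : ∀ m → let G , r = spine m in Bounded k none (suc m) (degree⁺ G r) G
  spine-bound zero    d S D≡d _ = +-monoˡ-≤ 0 (≤-trans (∣B∣≤occurrences D≡d) (base d))
    where
    base : ∀ d → occurrences (degree⁺ (single ◂ 0F) 0F) d ≤ 1
    base 0                   = z≤n
    base 1                   = ≤-refl
    base 2                   = ≤-refl
    base (suc (suc (suc _))) = z≤n
  spine-bound (suc m) = let G , r = spine m in
    extend-bound {e = none} {none} G (Pointed.graph (step (G , r))) (Vec.lookup (1 ∷ 2 ∷ 3 ∷ []))
      (λ { 0F → degree-new (G ◂ r ◂ 0F) 0F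
         ; 1F → cong suc (degree-new (G ◂ r) 0F)
         ; 2F → cong (_+_ 2) (degree-new G r) })
      -- Only x is attached to an old vertex, and `degree⁺` has already counted that edge; the
      -- comparisons for the other new edges compute to false.
      (λ u → refl)
      (λ { (q ∷ p ∷ x ∷ []) → ◂-independent G r x ∘ ◂-independent (G ◂ r) 0F p ∘ ◂-independent (G ◂ r ◂ 0F) 0F q })
      (λ d B D≡d _ → +-monoˡ-≤ 0 (≤-trans (∣B∣≤occurrences D≡d) (occurrences≤1 d)))
      (spine-bound m)

  tree-bound : ∀ m → Bounded k none (2 + m) (Graph.degree (tree m)) (tree m)
  tree-bound m = let G , r = spine m in
    extend-bound {e = none} {none} G (tree m) (Vec.lookup (1 ∷ 2 ∷ []))
      (λ { 0F → degree-new (G ◂ r) 0F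
         ; 1F → cong suc (degree-new G r) })
      (λ u → refl)
      (λ { (q ∷ p ∷ []) → ◂-independent G r p ∘ ◂-independent (G ◂ r) 0F q })
      (λ d B D≡d _ → +-monoˡ-≤ 0 (≤-trans (∣B∣≤occurrences D≡d) (occurrences≤1′ d)))
      (spine-bound m)

  size : ∀ m → Pointed.size (spine m) ≡ m * 3 + 2
  size zero    = refl
  size (suc m) = cong (_+_ 3) (size m)

  m<size : ∀ m → m < Pointed.size (spine m)
  m<size zero    = s≤s z≤n
  m<size (suc m) = s≤s (m≤n⇒m≤o+n 2 (m<size m))

  tree-large : ∀ m → 2 + m ≤ 2 + Pointed.size (spine m)
  tree-large m = s≤s (m≤n⇒m≤o+n 1 (m<size m))

  bound-attained : ∀ m → (2 + m) * 3 ≡ 2 + Pointed.size (spine m) + 2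
  bound-attained m rewrite size m = identity m
    where
    identity : ∀ m → (2 + m) * 3 ≡ 2 + (m * 3 + 2) + 2
    identity = solve-∀

-- Extremal trees for `k` = 0.

-- A step attaches a spine vertex x to the tip and a leg p, q, r′ to x; the new indices run r′, q, p, x.
module Legs3 where

  step : Pointed → Pointed
  step (G , r) = G ◂ r ◂ 0F ◂ 0F ◂ 0F , 3F

  spine : ℕ → Pointed
  spine zero    = single ◂ 0F ◂ 0F , 0F
  spine (suc m) = step (spine m)

  tree : ∀ m → Graph (3 + Pointed.size (spine m))
  tree m = let G , r = spine m in G ◂ r ◂ 0F ◂ 0F

  spine-grown : ∀ m → Grown (Pointed.graph (spine m))
  spine-grown zero    = ◂-grown _ (◂-grown _ single-grown)
  spine-grown (suc m) = ◂-grown _ (◂-grown _ (◂-grown _ (◂-grown _ (spine-grown m))))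

  tree-grown : ∀ m → Grown (tree m)
  tree-grown m = ◂-grown _ (◂-grown _ (◂-grown _ (spine-grown m)))

  -- The only degree that occurs twice in a block is 2, and those two vertices are adjacent, so
  -- every degree again yields at most one vertex per block.
  spine-bound : ∀ m → let G , r = spine m in Bounded 0 none (suc m) (degree⁺ G r) G
  spine-bound zero d S D≡d ind = +-monoˡ-≤ 0 (base d D≡d)
    where
    G₀ = single ◂ 0F ◂ 0F
    base : ∀ d → (∀ {u} → u ∈ S → degree⁺ G₀ 0F u ≡ d) → ∣ S ∣ ≤ 1
    base 0                   D≡d = ≤-trans (∣B∣≤occurrences D≡d) z≤n
    base 1                   D≡d = ∣B∣≤occurrences D≡d
    base 2                   D≡d = edge-bound {G = G₀} {f = λ i → i} (λ i∈ → i∈) D≡d ≤-refl ind 0F 1F refl refl refl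
    base (suc (suc (suc _))) D≡d = ≤-trans (∣B∣≤occurrences D≡d) z≤n
  spine-bound (suc m) = let G , r = spine m in
    extend-bound {e = none} {none} G G′ (Vec.lookup (1 ∷ 2 ∷ 2 ∷ 3 ∷ []))
      (λ { 0F → degree-new (G ◂ r ◂ 0F ◂ 0F) 0F
         ; 1F → cong suc (degree-new (G ◂ r ◂ 0F) 0F)
         ; 2F → cong suc (degree-new (G ◂ r) 0F)
         ; 3F → cong (_+_ 2) (degree-new G r) })
      (λ u → refl)
      (λ { (r′ ∷ q ∷ p ∷ x ∷ []) → ◂-independent G r x ∘ ◂-independent (G ◂ r) 0F p
                                 ∘ ◂-independent (G ◂ r ◂ 0F) 0F q ∘ ◂-independent (G ◂ r ◂ 0F ◂ 0F) 0F r′ })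
      (λ d B D≡d ind → +-monoˡ-≤ 0 (local d B D≡d ind))
      (spine-bound m)
    where
    G′ = Pointed.graph (spine (suc m))
    local : ∀ d B {S} → (∀ {i} → i ∈ B → Vec.lookup (1 ∷ 2 ∷ 2 ∷ 3 ∷ []) i ≡ d) →
            Graph.IsIndependent G′ 0 (B ++ S) → ∣ B ∣ ≤ 1
    local 0                         B D≡d ind = ≤-trans (∣B∣≤occurrences D≡d) z≤n
    local 1                         B D≡d ind = ∣B∣≤occurrences D≡d
    local 2                         B D≡d ind = edge-bound {G = G′} (∈-++⁺ˡ _) D≡d ≤-refl ind 1F 2F refl refl refl
    local 3                         B D≡d ind = ∣B∣≤occurrences D≡d
    local (suc (suc (suc (suc _)))) B D≡d ind = ≤-trans (∣B∣≤occurrences D≡d) z≤n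

  tree-bound : ∀ m → Bounded 0 none (2 + m) (Graph.degree (tree m)) (tree m)
  tree-bound m = let G , r = spine m in
    extend-bound {e = none} {none} G (tree m) (Vec.lookup (1 ∷ 2 ∷ 2 ∷ []))
      (λ { 0F → degree-new (G ◂ r ◂ 0F) 0F
         ; 1F → cong suc (degree-new (G ◂ r) 0F)
         ; 2F → cong suc (degree-new G r) })
      (λ u → refl)
      (λ { (r′ ∷ q ∷ p ∷ []) → ◂-independent G r p ∘ ◂-independent (G ◂ r) 0F q ∘ ◂-independent (G ◂ r ◂ 0F) 0F r′ })
      (λ d B D≡d ind → +-monoˡ-≤ 0 (local d B D≡d ind))
      (spine-bound m)
    where
    local : ∀ d B {S} → (∀ {i} → i ∈ B → Vec.lookup (1 ∷ 2 ∷ 2 ∷ []) i ≡ d) →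
            Graph.IsIndependent (tree m) 0 (B ++ S) → ∣ B ∣ ≤ 1
    local 0                   B D≡d ind = ≤-trans (∣B∣≤occurrences D≡d) z≤n
    local 1                   B D≡d ind = ∣B∣≤occurrences D≡d
    local 2                   B D≡d ind = edge-bound {G = tree m} (∈-++⁺ˡ _) D≡d ≤-refl ind 1F 2F refl refl refl
    local (suc (suc (suc _))) B D≡d ind = ≤-trans (∣B∣≤occurrences D≡d) z≤n

  size : ∀ m → Pointed.size (spine m) ≡ m * 4 + 3
  size zero    = refl
  size (suc m) = cong (_+_ 4) (size m)

  m<size : ∀ m → m < Pointed.size (spine m)
  m<size zero    = s≤s z≤n
  m<size (suc m) = s≤s (m≤n⇒m≤o+n 3 (m<size m))

  tree-large : ∀ m → 2 + m ≤ 3 + Pointed.size (spine m)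
  tree-large m = s≤s (m≤n⇒m≤o+n 2 (m<size m))

  bound-attained : ∀ m → (2 + m) * 4 ≡ 3 + Pointed.size (spine m) + 2
  bound-attained m rewrite size m = identity m
    where
    identity : ∀ m → (2 + m) * 4 ≡ 3 + (m * 4 + 3) + 2
    identity = solve-∀

-- Extremal trees for `k` = 1.

-- A step attaches a spine vertex x to the tip, then to x a leaf and a second spine vertex y, and then
-- to y a leg with four vertices. The new degrees, newest vertex first, are 1, 2, 2, 2 (leg), 3 (y),
-- 1 (leaf), 3 (x).
module Legs41 where

  step : Pointed → Pointed
  -- `1F` is x, shifted by its leaf; `4F` is y, shifted by the four vertices of its leg.
  step (G , r) = G ◂ r ◂ 0F ◂ 1F ◂ 0F ◂ 0F ◂ 0F ◂ 0F , 4F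

  spine : ℕ → Pointed
  spine zero    = single ◂ 0F ◂ 0F ◂ 0F , 0F
  spine (suc m) = step (spine m)

  tree : ∀ m → Graph (1 + Pointed.size (spine m))
  tree m = let G , r = spine m in G ◂ r

  spine-grown : ∀ m → Grown (Pointed.graph (spine m))
  spine-grown zero    = ◂-grown _ (◂-grown _ (◂-grown _ single-grown))
  spine-grown (suc m) =
    ◂-grown _ (◂-grown _ (◂-grown _ (◂-grown _ (◂-grown _ (◂-grown _ (◂-grown _ (spine-grown m)))))))

  tree-grown : ∀ m → Grown (tree m)
  tree-grown m = ◂-grown _ (spine-grown m)

  -- Room for the final leaf, which has no block of its own.
  reserve : ℕ → ℕ
  reserve = occurrences (Vec.lookup (1 ∷ []))

  -- A block has two vertices of degree 1, two of degree 3 and a path of three of degree 2, so each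
  -- degree yields at most 2. The starting path has one leaf, and the reserved one makes 2.
  spine-bound : ∀ m → let G , r = spine m in Bounded 1 reserve (suc m * 2) (degree⁺ G r) G
  spine-bound zero d S D≡d ind = base d D≡d
    where
    G₀ = single ◂ 0F ◂ 0F ◂ 0F
    base : ∀ d → (∀ {u} → u ∈ S → degree⁺ G₀ 0F u ≡ d) → ∣ S ∣ + reserve d ≤ 2
    base 0 D≡d = +-monoˡ-≤ 0 (≤-trans (∣B∣≤occurrences D≡d) z≤n)
    base 1 D≡d = +-monoˡ-≤ 1 (∣B∣≤occurrences D≡d)
    base 2 D≡d = +-monoˡ-≤ 0
      (path-bound {G = G₀} {f = λ i → i} (λ i∈ → i∈) D≡d ≤-refl ind 0F 1F 2F refl refl refl refl refl λ ())
    base (suc (suc (suc _))) D≡d = +-monoˡ-≤ 0 (≤-trans (∣B∣≤occurrences D≡d) z≤n)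
  spine-bound (suc m) =
    extend-bound {e = reserve} {reserve} G₀ G₇ (Vec.lookup (1 ∷ 2 ∷ 2 ∷ 2 ∷ 3 ∷ 1 ∷ 3 ∷ []))
      (λ { 0F → degree-new G₆ 0F
         ; 1F → cong suc (degree-new G₅ 0F)
         ; 2F → cong suc (degree-new G₄ 0F)
         ; 3F → cong suc (degree-new G₃ 0F)
         ; 4F → cong (_+_ 2) (degree-new G₂ 1F)
         ; 5F → degree-new G₁ 0F
         ; 6F → cong (_+_ 2) (degree-new G₀ r) })
      (λ u → refl)
      (λ { (b₇ ∷ b₆ ∷ b₅ ∷ b₄ ∷ b₃ ∷ b₂ ∷ b₁ ∷ []) →
           ◂-independent G₀ r b₁ ∘ ◂-independent G₁ 0F b₂ ∘ ◂-independent G₂ 1F b₃ ∘ ◂-independent G₃ 0F b₄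
         ∘ ◂-independent G₄ 0F b₅ ∘ ◂-independent G₅ 0F b₆ ∘ ◂-independent G₆ 0F b₇ })
      (λ d B D≡d ind → +-monoˡ-≤ (reserve d) (local d B D≡d ind))
      (spine-bound m)
    where
    G₀ = Pointed.graph (spine m)
    r  = Pointed.tip (spine m)
    G₁ = G₀ ◂ r
    G₂ = G₁ ◂ 0F
    G₃ = G₂ ◂ 1F
    G₄ = G₃ ◂ 0F
    G₅ = G₄ ◂ 0F
    G₆ = G₅ ◂ 0F
    G₇ = G₆ ◂ 0F
    local : ∀ d B {S} → (∀ {i} → i ∈ B → Vec.lookup (1 ∷ 2 ∷ 2 ∷ 2 ∷ 3 ∷ 1 ∷ 3 ∷ []) i ≡ d) →
            Graph.IsIndependent G₇ 1 (B ++ S) → ∣ B ∣ ≤ 2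
    local 0                         B D≡d ind = ≤-trans (∣B∣≤occurrences D≡d) z≤n
    local 1                         B D≡d ind = ∣B∣≤occurrences D≡d
    local 2                         B D≡d ind =
      path-bound {G = G₇} (∈-++⁺ˡ _) D≡d ≤-refl ind 1F 2F 3F refl refl refl refl refl λ ()
    local 3                         B D≡d ind = ∣B∣≤occurrences D≡d
    local (suc (suc (suc (suc _)))) B D≡d ind = ≤-trans (∣B∣≤occurrences D≡d) z≤n

  tree-bound : ∀ m → Bounded 1 none (suc m * 2) (Graph.degree (tree m)) (tree m)
  tree-bound m = let G , r = spine m in
    extend-bound {e = reserve} {none} G (tree m) (Vec.lookup (1 ∷ []))
      (λ { 0F → degree-new G r })
      (λ u → refl)
      (λ { (b ∷ []) → ◂-independent G r b })
      (λ d B D≡d ind → ≤-trans (≤-reflexive (+-identityʳ ∣ B ∣)) (∣B∣≤occurrences D≡d))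
      (spine-bound m)

  size : ∀ m → Pointed.size (spine m) ≡ m * 7 + 4
  size zero    = refl
  size (suc m) = cong (_+_ 7) (size m)

  m<size : ∀ m → m < Pointed.size (spine m)
  m<size zero    = s≤s z≤n
  m<size (suc m) = s≤s (m≤n⇒m≤o+n 6 (m<size m))

  tree-large : ∀ m → 2 + m ≤ 1 + Pointed.size (spine m)
  tree-large m = s≤s (m<size m)

  bound-attained : ∀ m → suc m * 2 * 7 ≡ 2 * (1 + Pointed.size (spine m) + 2)
  bound-attained m rewrite size m = identity m
    where
    identity : ∀ m → suc m * 2 * 7 ≡ 2 * (1 + (m * 7 + 4) + 2)
    identity = solve-∀

-- Rational form of the bounds and sharpness.

/-≥ : ∀ {x} a q .{{_ : NonZero q}} → x ≤ a * q → (+ a / 1) ≥ℚ (+ x / q)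
/-≥ {x} a q@(suc _) x≤aq =
  *≤* (subst₂ ℤ._≤_ (sym (ℤ.*-identityʳ (+ x))) (ℤ.pos-* a q) (ℤ.+≤+ x≤aq))

/-≃ : ∀ {x} a q .{{_ : NonZero q}} → a * q ≡ x → (+ a / 1) ≃ (+ x / q)
/-≃ {x} a q@(suc _) refl = *≡* (trans (sym (ℤ.pos-* a q)) (sym (ℤ.*-identityʳ (+ (a * q)))))

-- Only an upper bound on the parameter of `T m` has to be supplied; the general lower bound,
-- applied to `T m` itself, gives the other inequality.
sharp-family : ∀ k q .{{_ : NonZero q}} (numerator : ℕ → ℕ) →
  (∀ n → 2 ≤ n → (T : Graph n) → IsTree T → numerator n ≤ α k -reg T * q) →
  (size a : ℕ → ℕ) (T : ∀ m → Graph (size m)) → (∀ m → 2 + m ≤ size m) → (∀ m → IsTree (T m)) →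
  (∀ m → α k -reg (T m) ≤ a m) → (∀ m → a m * q ≡ numerator (size m)) →
  SharpForTrees (α k -reg_) (λ n → + numerator n / q)
sharp-family k q numerator lower size a T 2+m≤size T-tree upper a*q≡ m =
  size m , ≤-trans (m≤n+m m 2) (2+m≤size m) , 2≤size , T m , T-tree m ,
  /-≃ (α k -reg (T m)) q
    (≤-antisym (≤-trans (*-monoˡ-≤ q (upper m)) (≤-reflexive (a*q≡ m))) (lower (size m) 2≤size (T m) (T-tree m)))
  where
  2≤size : 2 ≤ size m
  2≤size = ≤-trans (m≤m+n 2 m) (2+m≤size m)

theorem2p1 : (∀ n → 2 ≤ n → (T : Graph n) → IsTree T →
    ((+ αreg T / 1) ≥ℚ (+ (n + 2) / 4))
    × ((+ (α 1 -reg T) / 1) ≥ℚ (+ (2 * (n + 2)) / 7))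
    × (∀ k → 2 ≤ k → (+ (α k -reg T) / 1) ≥ℚ (+ (n + 2) / 3)))
    × SharpForTrees αreg (λ n → + (n + 2) / 4)
    × SharpForTrees (α 1 -reg_) (λ n → + (2 * (n + 2)) / 7)
    × (∀ k → 2 ≤ k → SharpForTrees (α k -reg_) (λ n → + (n + 2) / 3))
theorem2p1 =
  (λ n 2≤n T T-tree → let open LowerBounds T T-tree 2≤n in
    /-≥ (αreg T) 4 α₀-bound , /-≥ (α 1 -reg T) 7 α₁-bound , λ k 2≤k → /-≥ (α k -reg T) 3 (αₖ-bound k 2≤k)) ,
  (let open Legs3 in
    sharp-family 0 4 (_+ 2) (λ n 2≤n T T-tree → LowerBounds.α₀-bound T T-tree 2≤n) _ (_+_ 2) tree
      tree-large (λ m → Grown.isTree (tree-grown m))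
      (λ m → bounded⇒α≤ {G = tree m} (tree-bound m)) bound-attained) ,
  (let open Legs41 in
    sharp-family 1 7 (λ n → 2 * (n + 2)) (λ n 2≤n T T-tree → LowerBounds.α₁-bound T T-tree 2≤n) _ (λ m → suc m * 2) tree
      tree-large (λ m → Grown.isTree (tree-grown m))
      (λ m → bounded⇒α≤ {G = tree m} (tree-bound m)) bound-attained) ,
  λ k 2≤k → let open Legs2 in
    sharp-family k 3 (_+ 2) (λ n 2≤n T T-tree → LowerBounds.αₖ-bound T T-tree 2≤n k 2≤k) _ (_+_ 2) tree
      tree-large (λ m → Grown.isTree (tree-grown m))
      (λ m → bounded⇒α≤ {G = tree m} (tree-bound m)) bound-attained
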